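{- Let $c>0$. Let $G$ be an $n$-vertex disk graph with $\alpha(G)=cn$, where $n$ is sufficiently large. Then $h(G)\le \frac{25n}{\log n}$.
   Context: All graphs are finite and simple; $\log$ is base $2$. A disk graph is the intersection graph of a finite family of disks in the plane (vertices are disks, adjacent iff the disks intersect). $\alpha(G)$ is the independence number. A hitting set of $G$ is a set $T\subseteq V(G)$ meeting every maximum independent set of $G$; $h(G)$ is the minimum size of a hitting set.
   Formalization: The disks have rational centres and rational positive radii instead of real ones; every finite disk graph has such a representation after slightly enlarging and perturbing the disks. -}

module Defs where

open import Data.Nat using (ℕ; _≤_)
open import Data.Fin using (Fin)
open import Data.Fin.Subset using (Subset; _∈_; ∣_∣)
open import Data.Product using (Σ; _×_; ∃)
open import Relation.Binary.PropositionalEquality using (_≡_; _≢_)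
open import Relation.Nullary using (¬_)
open import Data.Rational as ℚ using (ℚ; 0ℚ)

record Disk : Set where
  constructor disk
  field
    x : ℚ
    y : ℚ
    r : ℚ
    r>0 : 0ℚ ℚ.< r

open Disk

-- Two closed disks intersect iff the distance of the centres is at most
-- the sum of the radii (compared after squaring).
Intersect : Disk → Disk → Set
Intersect D E =
  ((x D ℚ.- x E) ℚ.* (x D ℚ.- x E)) ℚ.+ ((y D ℚ.- y E) ℚ.* (y D ℚ.- y E))
    ℚ.≤ (r D ℚ.+ r E) ℚ.* (r D ℚ.+ r E)

DiskGraph : ℕ → Set
DiskGraph n = Fin n → Disk

Adj : {n : ℕ} → DiskGraph n → Fin n → Fin n → Set
Adj G i j = i ≢ j × Intersect (G i) (G j)

Independent : {n : ℕ} → DiskGraph n → Subset n → Set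
Independent G S = ∀ i j → i ∈ S → j ∈ S → ¬ Adj G i j

IndependenceNumber : {n : ℕ} → DiskGraph n → ℕ → Set
IndependenceNumber {n} G k =
  (Σ (Subset n) λ S → Independent G S × ∣ S ∣ ≡ k) ×
  (∀ T → Independent G T → ∣ T ∣ ≤ k)

MaximumIndependent : {n : ℕ} → DiskGraph n → Subset n → Set
MaximumIndependent {n} G S =
  Independent G S × (∀ T → Independent G T → ∣ T ∣ ≤ ∣ S ∣)

HittingSet : {n : ℕ} → DiskGraph n → Subset n → Set
HittingSet {n} G T =
  ∀ S → MaximumIndependent G S → ∃ λ i → i ∈ T × i ∈ S

{-# OPTIONS --safe #-}
module Submission where

-- If U is obtained from the vertex set by deleting i disjoint cliques, an
-- independent set has at most i vertices outside U.  Choose d > i independent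
-- vertices of U, each time the smallest disk v not yet adjacent to a chosen one.
-- The union of their closed neighbourhoods in U is a hitting set, since otherwise
-- exchanging S ∩ U for (S ∩ U) ∪ {v₁, …, v_d} would enlarge a maximum independent
-- set S.  Disks meeting a smallest disk v and centred in the same octant around v
-- form a clique, so each of these neighbourhoods is a union of 8 cliques.  Hence
-- either the hitting set has at most b vertices, or U has a clique of size more
-- than b / 8d; delete it and continue.  For 2ᵗ ≤ i < 2ᵗ⁺¹ take d = 2ᵗ⁺¹: these
-- steps delete more than b / 16 vertices in total, so there are fewer than
-- 16 n / b such blocks.  With b = 25 n / log n this is (16/25) log n, and the first
-- (16/25) log n blocks only need d up to about n^(16/25), which is below α(G) = c n.

open import Defs
open import Data.Nat using (ℕ; _≤_; _*_; _^_)
open import Data.Fin.Subset using (Subset; ∣_∣)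
open import Data.Product using (Σ; _×_)
open import Relation.Binary.PropositionalEquality using (_≡_)
open import Data.Fin using (Fin; zero; suc)
open import Data.Fin.Properties using (_≟_)
open import Data.Fin.Subset using (_∈_; _∉_; _⊆_; _∩_; _∪_; _─_; ⁅_⁆; ⊤; ⊥; Empty; inside; outside)
open import Data.Fin.Subset.Properties
open import Data.Nat using (zero; suc; _+_; _<_; z≤n; s≤s; NonZero; >-nonZero)
open import Data.Nat.DivMod using (_/_; _%_; m≡m%n+[m/n]*n; m/n*n≤m; m%n<n)
import Data.Nat.Properties as ℕ
import Data.Nat.Solver as ℕSolver
open import Data.Product using (∃; _,_)
open import Data.Rational as ℚ using (ℚ; 0ℚ)
import Data.Rational.Properties as ℚ
import Data.Rational.Solver as ℚSolver
open import Data.Sum using (_⊎_; inj₁; inj₂)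
open import Data.Vec using ([]; _∷_; here; there; tabulate)
open import Data.Vec.Properties using (lookup∘tabulate; []=⇒lookup; lookup⇒[]=)
open import Function using (_∘_)
open import Relation.Binary.PropositionalEquality using (refl; sym; trans; cong; cong₂; subst; subst₂)
open import Relation.Nullary using (Dec; yes; no; ¬_; does; contradiction)
open import Relation.Nullary.Decidable using (dec-true)

open Disk

-- Geometry of an octant

SameSign : ℚ → ℚ → Set
SameSign a b = (0ℚ ℚ.≤ a × 0ℚ ℚ.≤ b) ⊎ (a ℚ.≤ 0ℚ × b ℚ.≤ 0ℚ)

sameSign-sym : ∀ {a b} → SameSign a b → SameSign b a
sameSign-sym (inj₁ (p , q)) = inj₁ (q , p)
sameSign-sym (inj₂ (p , q)) = inj₂ (q , p)

*-monoʳ : ∀ {a b c} → 0ℚ ℚ.≤ a → b ℚ.≤ c → a ℚ.* b ℚ.≤ a ℚ.* c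
*-monoʳ {a} 0≤a = ℚ.*-monoˡ-≤-nonNeg a ⦃ ℚ.nonNegative 0≤a ⦄

neg*neg : ∀ a b → (ℚ.- a) ℚ.* (ℚ.- b) ≡ a ℚ.* b
neg*neg = solve 2 (λ a b → (:- a) :* (:- b) := a :* b) refl
  where open ℚSolver.+-*-Solver

sameSign⇒0≤* : ∀ {a b} → SameSign a b → 0ℚ ℚ.≤ a ℚ.* b
sameSign⇒0≤* {a} {b} (inj₁ (p , q)) =
  subst (ℚ._≤ a ℚ.* b) (ℚ.*-zeroʳ a) (*-monoʳ p q)
sameSign⇒0≤* {a} {b} (inj₂ (p , q)) =
  subst (0ℚ ℚ.≤_) (neg*neg a b)
    (sameSign⇒0≤* (inj₁ (ℚ.neg-antimono-≤ p , ℚ.neg-antimono-≤ q)))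

-- The factor of smaller absolute value, replaced by the larger one of equal sign, can only raise
-- its square. The nonpositive case is the nonnegative one after negating both numbers.
sameSign⇒sq≤* : ∀ {a b} → SameSign a b →
  a ℚ.* a ℚ.≤ a ℚ.* b ⊎ b ℚ.* b ℚ.≤ a ℚ.* b
sameSign⇒sq≤* {a} {b} (inj₁ (p , q)) with ℚ.≤-total a b
... | inj₁ a≤b = inj₁ (*-monoʳ p a≤b)
... | inj₂ b≤a = inj₂ (subst (b ℚ.* b ℚ.≤_) (ℚ.*-comm b a) (*-monoʳ q b≤a))
sameSign⇒sq≤* {a} {b} (inj₂ (p , q))
  with sameSign⇒sq≤* (inj₁ (ℚ.neg-antimono-≤ p , ℚ.neg-antimono-≤ q))
... | inj₁ h = inj₁ (subst₂ ℚ._≤_ (neg*neg a a) (neg*neg a b) h)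
... | inj₂ h = inj₂ (subst₂ ℚ._≤_ (neg*neg b b) (neg*neg a b) h)

norm² : ℚ → ℚ → ℚ
norm² a c = a ℚ.* a ℚ.+ c ℚ.* c

-- For u = (a , c) and w = (b , d) this is what |w - u|² = |u|² + |w|² - 2 u·w needs in order to
-- stay below |u|². Both vectors lean to the first axis: if a² ≤ ab then |w|² ≤ |u|² ≤ 2a² ≤ 2ab,
-- and if b² ≤ ab then |w|² ≤ 2b² ≤ 2ab. The term 2cd only helps.
norm²≤2inner : ∀ {a b c d} → SameSign a b → SameSign c d →
  c ℚ.* c ℚ.≤ a ℚ.* a → d ℚ.* d ℚ.≤ b ℚ.* b → norm² b d ℚ.≤ norm² a c →
  norm² b d ℚ.≤ (a ℚ.* b ℚ.+ a ℚ.* b) ℚ.+ (c ℚ.* d ℚ.+ c ℚ.* d)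
norm²≤2inner {a} {b} {c} {d} ab cd c²≤a² d²≤b² q≤p =
  subst (ℚ._≤ (a ℚ.* b ℚ.+ a ℚ.* b) ℚ.+ (c ℚ.* d ℚ.+ c ℚ.* d)) (ℚ.+-identityʳ _)
    (ℚ.+-mono-≤ bound (ℚ.+-mono-≤ (sameSign⇒0≤* cd) (sameSign⇒0≤* cd)))
  where
  bound : norm² b d ℚ.≤ a ℚ.* b ℚ.+ a ℚ.* b
  bound with sameSign⇒sq≤* ab
  ... | inj₁ h = ℚ.≤-trans q≤p (ℚ.+-mono-≤ h (ℚ.≤-trans c²≤a² h))
  ... | inj₂ h = ℚ.+-mono-≤ h (ℚ.≤-trans d²≤b² h)

-- Two vectors at an angle of at most 45° are no further apart than the
-- length of the longer one.
distance²≤norm² : ∀ {a b c d} → SameSign a b → SameSign c d →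
  c ℚ.* c ℚ.≤ a ℚ.* a → d ℚ.* d ℚ.≤ b ℚ.* b → norm² b d ℚ.≤ norm² a c →
  norm² (b ℚ.- a) (d ℚ.- c) ℚ.≤ norm² a c
distance²≤norm² {a} {b} {c} {d} ab cd c²≤a² d²≤b² q≤p =
  subst₂ ℚ._≤_ (expand a b c d) (cancel (norm² a c) t)
    (ℚ.+-monoʳ-≤ (norm² a c)
      (ℚ.+-monoˡ-≤ (ℚ.- t) (norm²≤2inner ab cd c²≤a² d²≤b² q≤p)))
  where
  open ℚSolver.+-*-Solver
  t : ℚ
  t = (a ℚ.* b ℚ.+ a ℚ.* b) ℚ.+ (c ℚ.* d ℚ.+ c ℚ.* d)
  expand : ∀ a b c d → norm² a c ℚ.+ (norm² b d ℚ.+ ℚ.- ((a ℚ.* b ℚ.+ a ℚ.* b) ℚ.+ (c ℚ.* d ℚ.+ c ℚ.* d)))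
    ≡ norm² (b ℚ.- a) (d ℚ.- c)
  expand = solve 4 (λ a b c d →
    (a :* a :+ c :* c) :+ ((b :* b :+ d :* d) :+ :- ((a :* b :+ a :* b) :+ (c :* d :+ c :* d)))
    := (b :+ :- a) :* (b :+ :- a) :+ (d :+ :- c) :* (d :+ :- c)) refl
  cancel : ∀ m t → m ℚ.+ (t ℚ.+ ℚ.- t) ≡ m
  cancel = solve 2 (λ m t → m :+ (t :+ :- t) := m) refl

-- Arguments are grouped by coordinate: the two vectors are (a , c) and (b , d). Squares stand in
-- for absolute values.
SameSlope : ℚ → ℚ → ℚ → ℚ → Set
SameSlope a b c d =
  (c ℚ.* c ℚ.≤ a ℚ.* a × d ℚ.* d ℚ.≤ b ℚ.* b) ⊎
  (a ℚ.* a ℚ.≤ c ℚ.* c × b ℚ.* b ℚ.≤ d ℚ.* d)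

SameOctant : ℚ → ℚ → ℚ → ℚ → Set
SameOctant a b c d = SameSign a b × SameSign c d × SameSlope a b c d

sameOctant-sym : ∀ {a b c d} → SameOctant a b c d → SameOctant b a d c
sameOctant-sym (s , s' , inj₁ (p , q)) = sameSign-sym s , sameSign-sym s' , inj₁ (q , p)
sameOctant-sym (s , s' , inj₂ (p , q)) = sameSign-sym s , sameSign-sym s' , inj₂ (q , p)

sameOctant⇒distance²≤norm² : ∀ {a b c d} → SameOctant a b c d →
  norm² b d ℚ.≤ norm² a c → norm² (b ℚ.- a) (d ℚ.- c) ℚ.≤ norm² a c
sameOctant⇒distance²≤norm² (ab , cd , inj₁ (p , q)) h = distance²≤norm² ab cd p q h
sameOctant⇒distance²≤norm² {a} {b} {c} {d} (ab , cd , inj₂ (p , q)) h =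
  subst₂ ℚ._≤_ (ℚ.+-comm ((d ℚ.- c) ℚ.* (d ℚ.- c)) _) (ℚ.+-comm (c ℚ.* c) _)
    (distance²≤norm² cd ab p q
      (subst₂ ℚ._≤_ (ℚ.+-comm (b ℚ.* b) _) (ℚ.+-comm (a ℚ.* a) _) h))

square-mono : ∀ {a b} → 0ℚ ℚ.≤ a → a ℚ.≤ b → a ℚ.* a ℚ.≤ b ℚ.* b
square-mono {a} {b} 0≤a a≤b =
  ℚ.≤-trans (*-monoʳ 0≤a a≤b)
    (subst (ℚ._≤ b ℚ.* b) (ℚ.*-comm b a) (*-monoʳ (ℚ.≤-trans 0≤a a≤b) a≤b))

r≥0 : ∀ D → 0ℚ ℚ.≤ r D
r≥0 D = ℚ.<⇒≤ (r>0 D)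

0≤r+r : ∀ D E → 0ℚ ℚ.≤ r D ℚ.+ r E
0≤r+r D E = ℚ.+-mono-≤ (r≥0 D) (r≥0 E)

sub-sub : ∀ v d e → (v ℚ.- e) ℚ.- (v ℚ.- d) ≡ d ℚ.- e
sub-sub = solve 3 (λ v d e → (v :+ :- e) :+ :- (v :+ :- d) := d :+ :- e) refl
  where open ℚSolver.+-*-Solver

intersect-sym : ∀ D E → Intersect D E → Intersect E D
intersect-sym D E = subst₂ ℚ._≤_
  (flipped (x D) (x E) (y D) (y E))
  (cong (λ s → s ℚ.* s) (ℚ.+-comm (r D) (r E)))
  where
  open ℚSolver.+-*-Solver
  flipped : ∀ a b c d → norm² (a ℚ.- b) (c ℚ.- d) ≡ norm² (b ℚ.- a) (d ℚ.- c)
  flipped = solve 4 (λ a b c d →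
    (a :+ :- b) :* (a :+ :- b) :+ (c :+ :- d) :* (c :+ :- d)
    := (b :+ :- a) :* (b :+ :- a) :+ (d :+ :- c) :* (d :+ :- c)) refl

intersect-refl : ∀ D → Intersect D D
intersect-refl D =
  subst (ℚ._≤ (r D ℚ.+ r D) ℚ.* (r D ℚ.+ r D))
    (sym (cong₂ norm² (ℚ.+-inverseʳ (x D)) (ℚ.+-inverseʳ (y D))))
    (square-mono ℚ.≤-refl (0≤r+r D D))

intersect? : ∀ D E → Dec (Intersect D E)
intersect? D E =
  norm² (x D ℚ.- x E) (y D ℚ.- y E) ℚ.≤? (r D ℚ.+ r E) ℚ.* (r D ℚ.+ r E)

SameOctantFrom : Disk → Disk → Disk → Set
SameOctantFrom V D E =
  SameOctant (x V ℚ.- x D) (x V ℚ.- x E) (y V ℚ.- y D) (y V ℚ.- y E)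

-- With `D` the farther centre, the distance from `D` to `E` is at most that from `V` to `D`, hence
-- at most `r V + r D`, and `r V` may be raised to `r E`.
sameOctant⇒intersect-farther : ∀ V D E → r V ℚ.≤ r E →
  Intersect V D → SameOctantFrom V D E →
  norm² (x V ℚ.- x E) (y V ℚ.- y E) ℚ.≤ norm² (x V ℚ.- x D) (y V ℚ.- y D) → Intersect D E
sameOctant⇒intersect-farther V D E V≤E VD oct h =
  subst (ℚ._≤ (r D ℚ.+ r E) ℚ.* (r D ℚ.+ r E))
    (cong₂ norm² (sub-sub (x V) (x D) (x E)) (sub-sub (y V) (y D) (y E)))
    (ℚ.≤-trans (sameOctant⇒distance²≤norm² oct h)
      (ℚ.≤-trans VD (square-mono (0≤r+r V D)
        (subst (r V ℚ.+ r D ℚ.≤_) (ℚ.+-comm (r E) (r D)) (ℚ.+-monoˡ-≤ (r D) V≤E)))))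

sameOctant⇒intersect : ∀ V D E → r V ℚ.≤ r D → r V ℚ.≤ r E →
  Intersect V D → Intersect V E → SameOctantFrom V D E → Intersect D E
sameOctant⇒intersect V D E V≤D V≤E VD VE oct
  with ℚ.≤-total (norm² (x V ℚ.- x E) (y V ℚ.- y E)) (norm² (x V ℚ.- x D) (y V ℚ.- y D))
... | inj₁ h = sameOctant⇒intersect-farther V D E V≤E VD oct h
... | inj₂ h = intersect-sym E D
  (sameOctant⇒intersect-farther V E D V≤D VE (sameOctant-sym oct) h)

-- Finite subsets

∣p∣≡∣p∩q∣+∣p─q∣ : ∀ {n} (p q : Subset n) → ∣ p ∣ ≡ ∣ p ∩ q ∣ + ∣ p ─ q ∣
∣p∣≡∣p∩q∣+∣p─q∣ [] [] = refl
∣p∣≡∣p∩q∣+∣p─q∣ (outside ∷ p) (outside ∷ q) = ∣p∣≡∣p∩q∣+∣p─q∣ p q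
∣p∣≡∣p∩q∣+∣p─q∣ (outside ∷ p) (inside ∷ q) = ∣p∣≡∣p∩q∣+∣p─q∣ p q
∣p∣≡∣p∩q∣+∣p─q∣ (inside ∷ p) (inside ∷ q) = cong suc (∣p∣≡∣p∩q∣+∣p─q∣ p q)
∣p∣≡∣p∩q∣+∣p─q∣ (inside ∷ p) (outside ∷ q) =
  trans (cong suc (∣p∣≡∣p∩q∣+∣p─q∣ p q)) (sym (ℕ.+-suc ∣ p ∩ q ∣ ∣ p ─ q ∣))

∣p∪q∣≤∣p∣+∣q∣ : ∀ {n} (p q : Subset n) → ∣ p ∪ q ∣ ≤ ∣ p ∣ + ∣ q ∣
∣p∪q∣≤∣p∣+∣q∣ [] [] = z≤n
∣p∪q∣≤∣p∣+∣q∣ (outside ∷ p) (outside ∷ q) = ∣p∪q∣≤∣p∣+∣q∣ p q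
∣p∪q∣≤∣p∣+∣q∣ (outside ∷ p) (inside ∷ q) =
  subst (suc ∣ p ∪ q ∣ ≤_) (sym (ℕ.+-suc ∣ p ∣ ∣ q ∣)) (s≤s (∣p∪q∣≤∣p∣+∣q∣ p q))
∣p∪q∣≤∣p∣+∣q∣ (inside ∷ p) (outside ∷ q) = s≤s (∣p∪q∣≤∣p∣+∣q∣ p q)
∣p∪q∣≤∣p∣+∣q∣ (inside ∷ p) (inside ∷ q) =
  s≤s (ℕ.≤-trans (∣p∪q∣≤∣p∣+∣q∣ p q) (ℕ.+-monoʳ-≤ ∣ p ∣ (ℕ.n≤1+n ∣ q ∣)))

x∈p─q⇒x∉q : ∀ {n} (p q : Subset n) → ∀ {i} → i ∈ p ─ q → i ∉ q
x∈p─q⇒x∉q (_ ∷ p) (outside ∷ q) here ()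
x∈p─q⇒x∉q (_ ∷ p) (_ ∷ q) (there h) (there h') = x∈p─q⇒x∉q p q h h'

x∉p⇒∣p∣<∣⁅x⁆∪p∣ : ∀ {n} (i : Fin n) (p : Subset n) → i ∉ p → ∣ p ∣ < ∣ ⁅ i ⁆ ∪ p ∣
x∉p⇒∣p∣<∣⁅x⁆∪p∣ i p i∉p = p⊂q⇒∣p∣<∣q∣
  (q⊆p∪q ⁅ i ⁆ p , i , p⊆p∪q p (x∈⁅x⁆ i) , i∉p)

Empty⇒∣p∣≡0 : ∀ {n} (p : Subset n) → Empty p → ∣ p ∣ ≡ 0
Empty⇒∣p∣≡0 {n} p e = trans (cong ∣_∣ (Empty-unique e)) (∣⊥∣≡0 n)

subsingleton⇒∣p∣≤1 : ∀ {n} (p : Subset n) → (∀ {i j} → i ∈ p → j ∈ p → i ≡ j) → ∣ p ∣ ≤ 1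
subsingleton⇒∣p∣≤1 p h with nonempty? p
... | no e = ℕ.≤-trans (ℕ.≤-reflexive (Empty⇒∣p∣≡0 p e)) z≤n
... | yes (i , i∈p) = ℕ.≤-trans
  (p⊆q⇒∣p∣≤∣q∣ λ j∈p → subst (_∈ ⁅ i ⁆) (h i∈p j∈p) (x∈⁅x⁆ i))
  (ℕ.≤-reflexive (∣⁅x⁆∣≡1 i))

module _ {n} {P : Fin n → Set} (P? : ∀ i → Dec (P i)) where

  select : Subset n
  select = tabulate (does ∘ P?)

  ∈-select⁺ : ∀ {i} → P i → i ∈ select
  ∈-select⁺ {i} Pi = lookup⇒[]= i select
    (trans (lookup∘tabulate (does ∘ P?) i) (dec-true (P? i) Pi))

  ∈-select⁻ : ∀ {i} → i ∈ select → P i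
  ∈-select⁻ {i} h with P? i | trans (sym (lookup∘tabulate (does ∘ P?) i)) ([]=⇒lookup h)
  ... | yes Pi | _ = Pi
  ... | no _ | ()

  -- The larger of the two parts cut out by `P` is kept. Doubling the multiplier `c` instead of
  -- halving the size avoids rounding.
  halve : ∀ {b} c (p : Subset n) → b < c * ∣ p ∣ →
    ∃ λ q → q ⊆ p × b < (c + c) * ∣ q ∣ × ((∀ {i} → i ∈ q → P i) ⊎ (∀ {i} → i ∈ q → ¬ P i))
  halve {b} c p b<c∣p∣ with ℕ.≤-total ∣ p ─ select ∣ ∣ p ∩ select ∣
    | subst (b <_)
        (trans (cong (c *_) (∣p∣≡∣p∩q∣+∣p─q∣ p select)) (ℕ.*-distribˡ-+ c ∣ p ∩ select ∣ _)) b<c∣p∣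
  ... | inj₁ le | b<parts = p ∩ select , p∩q⊆p p select ,
    ℕ.<-≤-trans b<parts (ℕ.≤-trans (ℕ.+-monoʳ-≤ _ (ℕ.*-monoʳ-≤ c le))
      (ℕ.≤-reflexive (sym (ℕ.*-distribʳ-+ _ c c)))) ,
    inj₁ λ h → ∈-select⁻ (p∩q⊆q p select h)
  ... | inj₂ le | b<parts = p ─ select , p─q⊆p p select ,
    ℕ.<-≤-trans b<parts (ℕ.≤-trans (ℕ.+-monoˡ-≤ _ (ℕ.*-monoʳ-≤ c le))
      (ℕ.≤-reflexive (sym (ℕ.*-distribʳ-+ _ c c)))) ,
    inj₂ λ h Pi → x∈p─q⇒x∉q p select h (∈-select⁺ Pi)

argmin : ∀ {n} (f : Fin n → ℚ) (p : Subset n) →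
  Empty p ⊎ (∃ λ v → v ∈ p × (∀ {u} → u ∈ p → f v ℚ.≤ f u))
argmin f [] = inj₁ λ ()
argmin f (s ∷ p) with argmin (f ∘ suc) p
argmin f (outside ∷ p) | inj₁ e = inj₁ λ { (suc i , there i∈p) → e (i , i∈p) }
argmin f (inside ∷ p) | inj₁ e = inj₂ (zero , here ,
  λ { here → ℚ.≤-refl ; (there i∈p) → contradiction (_ , i∈p) e })
argmin f (outside ∷ p) | inj₂ (v , v∈p , min) =
  inj₂ (suc v , there v∈p , λ { (there u∈p) → min u∈p })
argmin f (inside ∷ p) | inj₂ (v , v∈p , min) with ℚ.≤-total (f zero) (f (suc v))
... | inj₁ le = inj₂ (zero , here , λ { here → ℚ.≤-refl ; (there u∈p) → ℚ.≤-trans le (min u∈p) })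
... | inj₂ le = inj₂ (suc v , there v∈p , λ { here → le ; (there u∈p) → min u∈p })

-- Cliques and exchanges

halves⇒sameSign : ∀ a b →
  (0ℚ ℚ.≤ a × 0ℚ ℚ.≤ b) ⊎ (¬ 0ℚ ℚ.≤ a × ¬ 0ℚ ℚ.≤ b) → SameSign a b
halves⇒sameSign a b (inj₁ h) = inj₁ h
halves⇒sameSign a b (inj₂ (p , q)) = inj₂ (ℚ.<⇒≤ (ℚ.≰⇒> p) , ℚ.<⇒≤ (ℚ.≰⇒> q))

halves⇒sameSlope : ∀ a b c d →
  (c ℚ.* c ℚ.≤ a ℚ.* a × d ℚ.* d ℚ.≤ b ℚ.* b) ⊎
  (¬ c ℚ.* c ℚ.≤ a ℚ.* a × ¬ d ℚ.* d ℚ.≤ b ℚ.* b) → SameSlope a b c d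
halves⇒sameSlope a b c d (inj₁ h) = inj₁ h
halves⇒sameSlope a b c d (inj₂ (p , q)) = inj₂ (ℚ.<⇒≤ (ℚ.≰⇒> p) , ℚ.<⇒≤ (ℚ.≰⇒> q))

pairwise : ∀ {n} (P : Fin n → Set) {p : Subset n} →
  (∀ {i} → i ∈ p → P i) ⊎ (∀ {i} → i ∈ p → ¬ P i) →
  ∀ {i j} → i ∈ p → j ∈ p → (P i × P j) ⊎ (¬ P i × ¬ P j)
pairwise P (inj₁ h) i∈p j∈p = inj₁ (h i∈p , h j∈p)
pairwise P (inj₂ h) i∈p j∈p = inj₂ (h i∈p , h j∈p)

eightfold : ∀ d s → ((d + d) + (d + d) + ((d + d) + (d + d))) * s ≡ 8 * (d * s)
eightfold = solve 2 (λ d s → ((d :+ d) :+ (d :+ d) :+ ((d :+ d) :+ (d :+ d))) :* s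
  := con 8 :* (d :* s)) refl
  where open ℕSolver.+-*-Solver

module _ {n : ℕ} (G : DiskGraph n) where

  -- `Intersect` instead of `Adj` makes the case i = j harmless, since every disk meets itself.
  Clique : Subset n → Set
  Clique C = ∀ {i j} → i ∈ C → j ∈ C → Intersect (G i) (G j)

  independent-⊆ : ∀ {S T} → T ⊆ S → Independent G S → Independent G T
  independent-⊆ T⊆S ind i j i∈T j∈T = ind i j (T⊆S i∈T) (T⊆S j∈T)

  ∣independent∩clique∣≤1 : ∀ {S C} → Independent G S → Clique C → ∣ S ∩ C ∣ ≤ 1
  ∣independent∩clique∣≤1 {S} {C} ind clq = subsingleton⇒∣p∣≤1 (S ∩ C) same
    where
    same : ∀ {i j} → i ∈ S ∩ C → j ∈ S ∩ C → i ≡ j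
    same {i} {j} i∈ j∈ with i ≟ j
    ... | yes i≡j = i≡j
    ... | no i≢j = contradiction
      (i≢j , clq (p∩q⊆q S C i∈) (p∩q⊆q S C j∈))
      (ind i j (p∩q⊆p S C i∈) (p∩q⊆p S C j∈))

  closedNbhd : Fin n → Subset n
  closedNbhd v = select (λ u → intersect? (G v) (G u))

  LargeClique : ℕ → ℕ → Subset n → Set
  LargeClique b d U = ∃ λ C → C ⊆ U × Clique C × b < 8 * (d * ∣ C ∣)

  largeClique-⊆ : ∀ b d {U V : Subset n} → U ⊆ V → LargeClique b d U → LargeClique b d V
  largeClique-⊆ b d U⊆V (C , C⊆U , rest) = C , (λ h → U⊆V (C⊆U h)) , rest

  dx dy : Fin n → Fin n → ℚ
  dx v u = x (G v) ℚ.- x (G u)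
  dy v u = y (G v) ℚ.- y (G u)

  -- Three halvings, by the sign of `dx`, the sign of `dy` and the larger of the two in absolute
  -- value, leave an octant around `v` with at least an eighth of `X`. It is a clique because `v` is
  -- smallest and meets all of `X`.
  octant-clique : ∀ {b} d v (X : Subset n) →
    (∀ {u} → u ∈ X → r (G v) ℚ.≤ r (G u)) → X ⊆ closedNbhd v → b < d * ∣ X ∣ →
    LargeClique b d X
  octant-clique {b} d v X min X⊆N b<d∣X∣ =
    let Y , Y⊆X , b<Y , signx = halve right? d X b<d∣X∣
        Z , Z⊆Y , b<Z , signy = halve above? (d + d) Y b<Y
        C , C⊆Z , b<C , slope = halve flat? ((d + d) + (d + d)) Z b<Z
        C⊆X : C ⊆ X
        C⊆X = λ h → Y⊆X (Z⊆Y (C⊆Z h))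
    in C , C⊆X
     , (λ {i} {j} i∈C j∈C → sameOctant⇒intersect (G v) (G i) (G j)
         (min (C⊆X i∈C)) (min (C⊆X j∈C))
         (adjacent (X⊆N (C⊆X i∈C))) (adjacent (X⊆N (C⊆X j∈C)))
         ( halves⇒sameSign (dx v i) (dx v j) (pairwise right signx (Z⊆Y (C⊆Z i∈C)) (Z⊆Y (C⊆Z j∈C)))
         , halves⇒sameSign (dy v i) (dy v j) (pairwise above signy (C⊆Z i∈C) (C⊆Z j∈C))
         , halves⇒sameSlope (dx v i) (dx v j) (dy v i) (dy v j) (pairwise flat slope i∈C j∈C)))
     , subst (b <_) (eightfold d ∣ C ∣) b<C
    where
    right above flat : Fin n → Set
    right u = 0ℚ ℚ.≤ dx v u
    above u = 0ℚ ℚ.≤ dy v u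
    flat u = dy v u ℚ.* dy v u ℚ.≤ dx v u ℚ.* dx v u
    right? : ∀ u → Dec (right u)
    right? u = 0ℚ ℚ.≤? dx v u
    above? : ∀ u → Dec (above u)
    above? u = 0ℚ ℚ.≤? dy v u
    flat? : ∀ u → Dec (flat u)
    flat? u = dy v u ℚ.* dy v u ℚ.≤? dx v u ℚ.* dx v u
    adjacent : ∀ {u} → u ∈ closedNbhd v → Intersect (G v) (G u)
    adjacent = ∈-select⁻ (λ u → intersect? (G v) (G u))

  -- T plays the role of the union of the closed neighbourhoods of v₁, …, v_m;
  -- the alternative Empty S accounts for U being exhausted before v_m is chosen.
  Exchange : ℕ → Subset n → Subset n → Set
  Exchange m U T = ∀ S → S ⊆ U → Independent G S → Empty (S ∩ T) →
    Empty S ⊎ (∃ λ S' → S' ⊆ U × Independent G S' × m + ∣ S ∣ ≤ ∣ S' ∣)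

  -- A set avoiding the neighbourhood of `v` already lies in `U ─ closedNbhd v`. The exchange made
  -- there stays away from `v`, so `v` can be added as one more vertex.
  exchange-closedNbhd : ∀ {m U T v} → v ∈ U → Exchange m (U ─ closedNbhd v) T →
    Exchange (suc m) U ((U ∩ closedNbhd v) ∪ T)
  exchange-closedNbhd {m} {U} {T} {v} v∈U exch S S⊆U ind avoid
    with exch S S⊆U─N ind (λ (i , h) → avoid (i ,
           x∈p∩q⁺ (p∩q⊆p S T h , q⊆p∪q (U ∩ closedNbhd v) T (p∩q⊆q S T h))))
    where
    S⊆U─N : S ⊆ U ─ closedNbhd v
    S⊆U─N i∈S = x∈p∧x∉q⇒x∈p─q (S⊆U i∈S) λ i∈N → avoid (_ ,
      x∈p∩q⁺ (i∈S , p⊆p∪q T (x∈p∩q⁺ (S⊆U i∈S , i∈N))))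
  ... | inj₁ empty = inj₁ empty
  ... | inj₂ (S' , S'⊆ , ind' , m+∣S∣≤) = inj₂
    ( ⁅ v ⁆ ∪ S' , add⊆U , add-independent
    , ℕ.≤-trans (s≤s m+∣S∣≤) (x∉p⇒∣p∣<∣⁅x⁆∪p∣ v S' λ v∈S' → apart v∈S' (intersect-refl (G v))))
    where
    apart : ∀ {i} → i ∈ S' → ¬ Intersect (G v) (G i)
    apart i∈S' vi = x∈p─q⇒x∉q U (closedNbhd v) (S'⊆ i∈S')
      (∈-select⁺ (λ u → intersect? (G v) (G u)) vi)
    add⊆U : ⁅ v ⁆ ∪ S' ⊆ U
    add⊆U h with x∈p∪q⁻ ⁅ v ⁆ S' h
    ... | inj₁ i∈v rewrite x∈⁅y⁆⇒x≡y v i∈v = v∈U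
    ... | inj₂ i∈S' = p─q⊆p U _ (S'⊆ i∈S')
    add-independent : Independent G (⁅ v ⁆ ∪ S')
    add-independent i j i∈ j∈ (i≢j , ij) with x∈p∪q⁻ ⁅ v ⁆ S' i∈ | x∈p∪q⁻ ⁅ v ⁆ S' j∈
    ... | inj₁ i∈v | inj₁ j∈v = i≢j (trans (x∈⁅y⁆⇒x≡y v i∈v) (sym (x∈⁅y⁆⇒x≡y v j∈v)))
    ... | inj₁ i∈v | inj₂ j∈S' rewrite x∈⁅y⁆⇒x≡y v i∈v = apart j∈S' ij
    ... | inj₂ i∈S' | inj₁ j∈v rewrite x∈⁅y⁆⇒x≡y v j∈v = apart i∈S' (intersect-sym (G i) (G v) ij)
    ... | inj₂ i∈S' | inj₂ j∈S' = ind' i j i∈S' j∈S' (i≢j , ij)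

  -- A greedy choice of `m` smallest disks. Each closed neighbourhood either has more than b / d
  -- vertices, and one of its octants is a large clique, or it adds at most `b` to `d * ∣ T ∣`. For
  -- m = d the total gives ∣ T ∣ ≤ b.
  clique-or-exchange : ∀ b d m U →
    LargeClique b d U ⊎
    (∃ λ T → d * ∣ T ∣ ≤ m * b × Exchange m U T)
  clique-or-exchange b d zero U =
    inj₂ (⊥ , ℕ.≤-reflexive (trans (cong (d *_) (∣⊥∣≡0 n)) (ℕ.*-zeroʳ d)) ,
      λ S S⊆U ind _ → inj₂ (S , S⊆U , ind , ℕ.≤-refl))
  clique-or-exchange b d (suc m) U with argmin (r ∘ G) U
  ... | inj₁ empty = inj₂ (⊥ ,
    ℕ.≤-trans (ℕ.≤-reflexive (trans (cong (d *_) (∣⊥∣≡0 n)) (ℕ.*-zeroʳ d))) z≤n ,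
    λ S S⊆U _ _ → inj₁ λ (i , i∈S) → empty (i , S⊆U i∈S))
  ... | inj₂ (v , v∈U , min) with d * ∣ U ∩ closedNbhd v ∣ ℕ.≤? b
  ... | no large = inj₁ (largeClique-⊆ b d (p∩q⊆p U (closedNbhd v))
    (octant-clique d v (U ∩ closedNbhd v)
      (λ h → min (p∩q⊆p U (closedNbhd v) h)) (p∩q⊆q U (closedNbhd v)) (ℕ.≰⇒> large)))
  ... | yes small with clique-or-exchange b d m (U ─ closedNbhd v)
  ... | inj₁ large = inj₁ (largeClique-⊆ b d (p─q⊆p U (closedNbhd v)) large)
  ... | inj₂ (T , d∣T∣≤mb , exch) = inj₂
    ( (U ∩ closedNbhd v) ∪ T
    , (begin
        d * ∣ (U ∩ closedNbhd v) ∪ T ∣           ≤⟨ ℕ.*-monoʳ-≤ d (∣p∪q∣≤∣p∣+∣q∣ (U ∩ closedNbhd v) T) ⟩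
        d * (∣ U ∩ closedNbhd v ∣ + ∣ T ∣)       ≡⟨ ℕ.*-distribˡ-+ d ∣ U ∩ closedNbhd v ∣ ∣ T ∣ ⟩
        d * ∣ U ∩ closedNbhd v ∣ + d * ∣ T ∣     ≤⟨ ℕ.+-mono-≤ small d∣T∣≤mb ⟩
        b + m * b                              ∎)
    , exchange-closedNbhd {m} {U} {T} {v} v∈U exch)
    where open ℕ.≤-Reasoning

  -- Of the `i` deleted cliques only this consequence is carried along.
  Defect : Subset n → ℕ → Set
  Defect U i = ∀ S → Independent G S → ∣ S ∣ ≤ ∣ S ∩ U ∣ + i

  defect-clique : ∀ {U C i} → Clique C → Defect U i → Defect (U ─ C) (suc i)
  defect-clique {U} {C} {i} clq def S ind = begin
    ∣ S ∣                                     ≤⟨ def S ind ⟩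
    ∣ S ∩ U ∣ + i                             ≡⟨ cong (_+ i) (∣p∣≡∣p∩q∣+∣p─q∣ (S ∩ U) C) ⟩
    ∣ (S ∩ U) ∩ C ∣ + ∣ (S ∩ U) ─ C ∣ + i     ≤⟨ ℕ.+-monoˡ-≤ i (ℕ.+-mono-≤
      (∣independent∩clique∣≤1 (independent-⊆ (p∩q⊆p S U) ind) clq)
      (p⊆q⇒∣p∣≤∣q∣ λ h → let h' = p─q⊆p (S ∩ U) C h in
        x∈p∩q⁺ (p∩q⊆p S U h' , x∈p∧x∉q⇒x∈p─q (p∩q⊆q S U h') (x∈p─q⇒x∉q (S ∩ U) C h)))) ⟩
    suc (∣ S ∩ (U ─ C) ∣ + i)                 ≡⟨ sym (ℕ.+-suc ∣ S ∩ (U ─ C) ∣ i) ⟩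
    ∣ S ∩ (U ─ C) ∣ + suc i                   ∎
    where open ℕ.≤-Reasoning

  -- If a maximum `S` missed `T`, the exchange would gain `d` vertices over `S ∩ U`, while giving up
  -- the rest of `S` costs at most i < d.
  exchange⇒hitting : ∀ {a d i U T} → IndependenceNumber G a → i < d → d ≤ a →
    Defect U i → Exchange d U T → HittingSet G T
  exchange⇒hitting {a} {d} {i} {U} {T} ((S₀ , ind₀ , ∣S₀∣≡a) , _) i<d d≤a def exch S (ind , max)
    with nonempty? (S ∩ T)
  ... | yes (j , j∈) = j , p∩q⊆q S T j∈ , p∩q⊆p S T j∈
  ... | no avoid with exch (S ∩ U) (p∩q⊆q S U) (independent-⊆ (p∩q⊆p S U) ind)
    (λ (j , h) → avoid (j , x∈p∩q⁺ (p∩q⊆p S U (p∩q⊆p (S ∩ U) T h) , p∩q⊆q (S ∩ U) T h)))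
  -- When `S` lies outside `U` no exchange is available, but then `S` has at most i < d ≤ a vertices
  -- and is not maximum.
  ... | inj₁ empty = contradiction
    (begin
      d                  ≤⟨ d≤a ⟩
      a                  ≡⟨ sym ∣S₀∣≡a ⟩
      ∣ S₀ ∣              ≤⟨ max S₀ ind₀ ⟩
      ∣ S ∣               ≤⟨ def S ind ⟩
      ∣ S ∩ U ∣ + i       ≡⟨ cong (_+ i) (Empty⇒∣p∣≡0 (S ∩ U) empty) ⟩
      i                  ∎)
    (ℕ.<⇒≱ i<d)
    where open ℕ.≤-Reasoning
  ... | inj₂ (S' , _ , ind' , le) = contradiction
    (begin
      d + ∣ S ∩ U ∣       ≤⟨ le ⟩
      ∣ S' ∣              ≤⟨ max S' ind' ⟩
      ∣ S ∣               ≤⟨ def S ind ⟩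
      ∣ S ∩ U ∣ + i       ≡⟨ ℕ.+-comm ∣ S ∩ U ∣ i ⟩
      i + ∣ S ∩ U ∣       ∎)
    (ℕ.<⇒≱ (ℕ.+-monoˡ-< ∣ S ∩ U ∣ i<d))
    where open ℕ.≤-Reasoning

  -- Iterated clique deletion in dyadic blocks

  module _ {a} (α : IndependenceNumber G a) (b : ℕ) where

    SmallHittingSet : Set
    SmallHittingSet = ∃ λ T → HittingSet G T × ∣ T ∣ ≤ b

    -- Progress is measured by the potential `8 * (d * ∣ U ∣)`: a clique of more than b / 8d
    -- vertices lowers it by at least `suc b`.
    clique-step : ∀ {d i U} .⦃ _ : NonZero d ⦄ → i < d → d ≤ a → Defect U i →
      SmallHittingSet ⊎
      (∃ λ U' → Defect U' (suc i) × 8 * (d * ∣ U' ∣) + suc b ≤ 8 * (d * ∣ U ∣))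
    clique-step {d} {i} {U} i<d d≤a def with clique-or-exchange b d d U
    ... | inj₂ (T , d∣T∣≤d*b , exch) = inj₁
      (T , exchange⇒hitting α i<d d≤a def exch , ℕ.*-cancelˡ-≤ d d∣T∣≤d*b)
    ... | inj₁ (C , C⊆U , clq , b<) = inj₂ (U ─ C , defect-clique clq def , bound)
      where
      open ℕ.≤-Reasoning
      bound : 8 * (d * ∣ U ─ C ∣) + suc b ≤ 8 * (d * ∣ U ∣)
      bound = begin
        8 * (d * ∣ U ─ C ∣) + suc b             ≤⟨ ℕ.+-monoʳ-≤ (8 * (d * ∣ U ─ C ∣)) b< ⟩
        8 * (d * ∣ U ─ C ∣) + 8 * (d * ∣ C ∣)    ≤⟨ ℕ.+-monoʳ-≤ (8 * (d * ∣ U ─ C ∣)) (ℕ.*-monoʳ-≤ 8 (ℕ.*-monoʳ-≤ d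
          (p⊆q⇒∣p∣≤∣q∣ λ h → x∈p∩q⁺ (C⊆U h , h)))) ⟩
        8 * (d * ∣ U ─ C ∣) + 8 * (d * ∣ U ∩ C ∣) ≡⟨ distrib d ∣ U ─ C ∣ ∣ U ∩ C ∣ ⟩
        8 * (d * (∣ U ∩ C ∣ + ∣ U ─ C ∣))        ≡⟨ cong (λ s → 8 * (d * s)) (sym (∣p∣≡∣p∩q∣+∣p─q∣ U C)) ⟩
        8 * (d * ∣ U ∣)                         ∎
        where
        open ℕSolver.+-*-Solver
        distrib : ∀ d s t → 8 * (d * s) + 8 * (d * t) ≡ 8 * (d * (t + s))
        distrib = solve 3 (λ d s t → con 8 :* (d :* s) :+ con 8 :* (d :* t)
          := con 8 :* (d :* (t :+ s))) refl

    clique-steps : ∀ {d i U} .⦃ _ : NonZero d ⦄ → d ≤ a → Defect U i → ∀ e → e + i ≤ d →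
      SmallHittingSet ⊎
      (∃ λ U' → Defect U' (e + i) × 8 * (d * ∣ U' ∣) + e * suc b ≤ 8 * (d * ∣ U ∣))
    clique-steps {U = U} d≤a def zero _ = inj₂ (U , def , ℕ.≤-reflexive (ℕ.+-identityʳ _))
    clique-steps {d} {i} {U} d≤a def (suc e) e+i<d
      with clique-steps d≤a def e (ℕ.<⇒≤ e+i<d)
    ... | inj₁ sol = inj₁ sol
    ... | inj₂ (V , defV , le) with clique-step e+i<d d≤a defV
    ... | inj₁ sol = inj₁ sol
    ... | inj₂ (W , defW , le') = inj₂ (W , defW , (begin
        8 * (d * ∣ W ∣) + (suc b + e * suc b)  ≡⟨ sym (ℕ.+-assoc (8 * (d * ∣ W ∣)) (suc b) _) ⟩
        8 * (d * ∣ W ∣) + suc b + e * suc b    ≤⟨ ℕ.+-monoˡ-≤ (e * suc b) le' ⟩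
        8 * (d * ∣ V ∣) + e * suc b            ≤⟨ le ⟩
        8 * (d * ∣ U ∣)                        ∎))
      where open ℕ.≤-Reasoning

    -- The threshold is fixed at `2 * d` while the defect grows from `d` to `2 * d`. The `d` steps
    -- lower 16 d ∣ U ∣ by `d * suc b`, and cancelling `d` makes the loss the same for every block.
    dyadic-block : ∀ {d U} .⦃ _ : NonZero d ⦄ → 2 * d ≤ a → Defect U d →
      SmallHittingSet ⊎
      (∃ λ U' → Defect U' (2 * d) × 16 * ∣ U' ∣ + suc b ≤ 16 * ∣ U ∣)
    dyadic-block {d} {U} 2d≤a def
      with clique-steps ⦃ ℕ.m*n≢0 2 d ⦄ 2d≤a def d
           (ℕ.≤-reflexive (cong (d +_) (sym (ℕ.+-identityʳ d))))
    ... | inj₁ sol = inj₁ sol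
    ... | inj₂ (V , defV , le) = inj₂
      ( V
      , subst (Defect V) (cong (d +_) (sym (ℕ.+-identityʳ d))) defV
      , ℕ.*-cancelˡ-≤ d (subst₂ _≤_ (regroup d ∣ V ∣ (suc b)) (scale d ∣ U ∣) le))
      where
      open ℕSolver.+-*-Solver
      scale : ∀ d s → 8 * (2 * d * s) ≡ d * (16 * s)
      scale = solve 2 (λ d s → con 8 :* (con 2 :* d :* s) := d :* (con 16 :* s)) refl
      regroup : ∀ d s t → 8 * (2 * d * s) + d * t ≡ d * (16 * s + t)
      regroup = solve 3 (λ d s t → con 8 :* (con 2 :* d :* s) :+ d :* t
        := d :* (con 16 :* s :+ t)) refl

    dyadic-blocks : ∀ k → 2 ^ k ≤ a →
      SmallHittingSet ⊎ (∃ λ U → Defect U (2 ^ k) × 16 * ∣ U ∣ + k * suc b ≤ 16 * n)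
    -- The full vertex set has defect 0, weakened here to 1 = 2 ^ 0 so that doubling can start.
    dyadic-blocks zero _ = inj₂
      ( ⊤
      , (λ S _ → subst (λ s → ∣ S ∣ ≤ ∣ s ∣ + 1) (sym (∩-identityʳ S)) (ℕ.m≤m+n ∣ S ∣ 1))
      , ℕ.≤-reflexive (trans (ℕ.+-identityʳ _) (cong (16 *_) (∣⊤∣≡n n))))
    dyadic-blocks (suc k) 2^k+1≤a
      with dyadic-blocks k (ℕ.≤-trans (ℕ.m≤m+n (2 ^ k) _) 2^k+1≤a)
    ... | inj₁ sol = inj₁ sol
    ... | inj₂ (U , def , le) with dyadic-block ⦃ ℕ.m^n≢0 2 k ⦄ 2^k+1≤a def
    ... | inj₁ sol = inj₁ sol
    ... | inj₂ (V , defV , le') = inj₂ (V , defV , (begin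
        16 * ∣ V ∣ + (suc b + k * suc b)  ≡⟨ sym (ℕ.+-assoc (16 * ∣ V ∣) (suc b) _) ⟩
        16 * ∣ V ∣ + suc b + k * suc b    ≤⟨ ℕ.+-monoˡ-≤ (k * suc b) le' ⟩
        16 * ∣ U ∣ + k * suc b            ≤⟨ le ⟩
        16 * n                           ∎))
      where open ℕ.≤-Reasoning

    small-hitting-set : ∀ k → 2 ^ k ≤ a → 16 * n < k * suc b → SmallHittingSet
    small-hitting-set k 2^k≤a many with dyadic-blocks k 2^k≤a
    ... | inj₁ sol = sol
    ... | inj₂ (U , _ , le) = contradiction (ℕ.≤-trans (ℕ.m≤n+m _ _) le) (ℕ.<⇒≱ many)

-- Choice of the parameters

-- `l` stands for log n rounded up; the factor 2 is the price of rounding.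
log₂-bracket : ∀ n → 1 ≤ n → ∃ λ l → n ≤ 2 ^ l × 2 ^ l ≤ 2 * n
log₂-bracket (suc zero) _ = 0 , s≤s z≤n , s≤s z≤n
log₂-bracket (suc n@(suc _)) _ with log₂-bracket n (s≤s z≤n)
... | l , n≤2^l , 2^l≤2n with suc n ℕ.≤? 2 ^ l
... | yes n<2^l = l , n<2^l , ℕ.≤-trans 2^l≤2n (ℕ.*-monoʳ-≤ 2 (ℕ.n≤1+n n))
... | no n≮2^l = suc l
  , ℕ.+-mono-≤ (ℕ.m^n>0 2 l) (ℕ.≤-trans n≤2^l (ℕ.m≤m+n (2 ^ l) 0))
  , ℕ.*-monoʳ-≤ 2 (ℕ.<⇒≤ (ℕ.≰⇒> n≮2^l))

n<2^n : ∀ n → n < 2 ^ n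
n<2^n zero = s≤s z≤n
n<2^n (suc n) = ℕ.+-mono-≤ (ℕ.m^n>0 2 n) (ℕ.≤-trans (n<2^n n) (ℕ.m≤m+n (2 ^ n) 0))

^-cancelˡ-≤ : ∀ m {n o} → 1 < m → m ^ n ≤ m ^ o → n ≤ o
^-cancelˡ-≤ m 1<m mⁿ≤mᵒ = ℕ.≮⇒≥ λ o<n → ℕ.<⇒≱ (ℕ.^-monoʳ-< m 1<m o<n) mⁿ≤mᵒ

m<n*suc[m/n] : ∀ m n .⦃ _ : NonZero n ⦄ → m < n * suc (m / n)
m<n*suc[m/n] m n = begin-strict
  m                    ≡⟨ m≡m%n+[m/n]*n m n ⟩
  m % n + m / n * n    <⟨ ℕ.+-monoˡ-< (m / n * n) (m%n<n m n) ⟩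
  suc (m / n) * n      ≡⟨ ℕ.*-comm (suc (m / n)) n ⟩
  n * suc (m / n)      ∎
  where open ℕ.≤-Reasoning

-- The least k above 16 l / 25 leaves about 9 l / 25 of the exponent for `q` and the rounding. It
-- suffices that 50 + 25 q ≤ 9 l, which 9 (6 + 3 q) ≤ 9 l ensures.
exponent : ∀ q l → 6 + 3 * q ≤ l → ∃ λ k → 16 * l < 25 * k × suc (k + q) ≤ l
exponent q l large = suc k₀ , m<n*suc[m/n] (16 * l) 25 , upper
  where
  open ℕ.≤-Reasoning
  open ℕSolver.+-*-Solver
  k₀ = 16 * l / 25
  upper : suc (suc k₀ + q) ≤ l
  upper = ℕ.*-cancelˡ-≤ 25 (begin
    25 * suc (suc k₀ + q)        ≡⟨ solve 2 (λ k q → con 25 :* (con 2 :+ (k :+ q))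
                                     := k :* con 25 :+ (con 50 :+ con 25 :* q)) refl k₀ q ⟩
    k₀ * 25 + (50 + 25 * q)      ≤⟨ ℕ.+-mono-≤ (m/n*n≤m (16 * l) 25)
                                     (ℕ.+-mono-≤ (ℕ.m≤m+n 50 4) (ℕ.*-monoˡ-≤ q (ℕ.m≤m+n 25 2))) ⟩
    16 * l + (54 + 27 * q)       ≡⟨ solve 2 (λ l q → con 16 :* l :+ (con 54 :+ con 27 :* q)
                                     := con 16 :* l :+ con 9 :* (con 6 :+ con 3 :* q)) refl l q ⟩
    16 * l + 9 * (6 + 3 * q)     ≤⟨ ℕ.+-monoʳ-≤ (16 * l) (ℕ.*-monoʳ-≤ 9 large) ⟩
    16 * l + 9 * l               ≡⟨ sym (ℕ.*-distribʳ-+ l 16 9) ⟩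
    25 * l                       ∎)

-- Here c = p / q is at least 1 / q, and the crude bound q < 2 ^ q turns division by `q` into a loss
-- of `q` in the exponent.
2^k≤a : ∀ {p q n a k l} → 1 ≤ p → 1 ≤ q → a * q ≡ p * n → 2 ^ l ≤ 2 * n → k + q < l → 2 ^ k ≤ a
2^k≤a {p} {q} {n} {a} {k} {l} 1≤p 1≤q aq≡pn 2^l≤2n k+q<l =
  ℕ.*-cancelʳ-≤ (2 ^ k) a q ⦃ >-nonZero 1≤q ⦄ (begin
    2 ^ k * q        ≤⟨ ℕ.*-monoʳ-≤ (2 ^ k) (ℕ.<⇒≤ (n<2^n q)) ⟩
    2 ^ k * 2 ^ q    ≡⟨ sym (ℕ.^-distribˡ-+-* 2 k q) ⟩
    2 ^ (k + q)      ≤⟨ ℕ.*-cancelˡ-≤ 2 (ℕ.≤-trans (ℕ.^-monoʳ-≤ 2 k+q<l) 2^l≤2n) ⟩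
    n                ≤⟨ ℕ.m≤n*m n p ⦃ >-nonZero 1≤p ⦄ ⟩
    p * n            ≡⟨ sym aq≡pn ⟩
    a * q            ∎)
  where open ℕ.≤-Reasoning

-- The conclusion is t log n ≤ 25 n in exponential form; it follows from log n ≤ l and t l ≤ 25 n.
∣T∣≤25n/l⇒n^∣T∣≤2^25n : ∀ n l t .⦃ _ : NonZero l ⦄ → n ≤ 2 ^ l → t ≤ 25 * n / l → n ^ t ≤ 2 ^ (25 * n)
∣T∣≤25n/l⇒n^∣T∣≤2^25n n l t n≤2^l t≤25n/l = begin
  n ^ t                   ≤⟨ ℕ.^-monoˡ-≤ t n≤2^l ⟩
  (2 ^ l) ^ t             ≡⟨ ℕ.^-*-assoc 2 l t ⟩
  2 ^ (l * t)             ≤⟨ ℕ.^-monoʳ-≤ 2 (ℕ.*-monoʳ-≤ l t≤25n/l) ⟩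
  2 ^ (l * (25 * n / l))  ≡⟨ cong (2 ^_) (ℕ.*-comm l (25 * n / l)) ⟩
  2 ^ (25 * n / l * l)    ≤⟨ ℕ.^-monoʳ-≤ 2 (m/n*n≤m (25 * n) l) ⟩
  2 ^ (25 * n)            ∎
  where open ℕ.≤-Reasoning

-- The product of k > 16 l / 25 and suc b > 25 n / l exceeds 16 n.
enough-blocks : ∀ n k l .⦃ _ : NonZero l ⦄ → 16 * l < 25 * k → 16 * n < k * suc (25 * n / l)
enough-blocks n k l 16l<25k = ℕ.*-cancelˡ-< 25 (16 * n) (k * suc b) (begin-strict
  25 * (16 * n)        ≡⟨ solve 1 (λ n → con 25 :* (con 16 :* n) := con 16 :* (con 25 :* n)) refl n ⟩
  16 * (25 * n)        <⟨ ℕ.*-monoʳ-< 16 (m<n*suc[m/n] (25 * n) l) ⟩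
  16 * (l * suc b)     ≡⟨ sym (ℕ.*-assoc 16 l (suc b)) ⟩
  16 * l * suc b       ≤⟨ ℕ.*-monoˡ-≤ (suc b) (ℕ.<⇒≤ 16l<25k) ⟩
  25 * k * suc b       ≡⟨ ℕ.*-assoc 25 k (suc b) ⟩
  25 * (k * suc b)     ∎)
  where
  open ℕ.≤-Reasoning
  open ℕSolver.+-*-Solver
  b : ℕ
  b = 25 * n / l

large⇒hitting-set : ∀ p q l → 1 ≤ p → 1 ≤ q → 6 + 3 * q ≤ l →
  ∀ {n} (G : DiskGraph n) {a} → IndependenceNumber G a → a * q ≡ p * n →
  n ≤ 2 ^ l → 2 ^ l ≤ 2 * n →
  Σ (Subset n) λ T → HittingSet G T × n ^ ∣ T ∣ ≤ 2 ^ (25 * n)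
large⇒hitting-set p q l 1≤p 1≤q 6+3q≤l {n} G {a} α aq≡pn n≤2^l 2^l≤2n =
  conclude (exponent q l 6+3q≤l)
  where
  instance
    l≢0 : NonZero l
    l≢0 = >-nonZero (ℕ.≤-trans (s≤s z≤n) 6+3q≤l)
  convert : SmallHittingSet G α (25 * n / l) →
    Σ (Subset n) λ T → HittingSet G T × n ^ ∣ T ∣ ≤ 2 ^ (25 * n)
  convert (T , hit , ∣T∣≤b) = T , hit , ∣T∣≤25n/l⇒n^∣T∣≤2^25n n l ∣ T ∣ n≤2^l ∣T∣≤b
  conclude : (∃ λ k → 16 * l < 25 * k × k + q < l) →
    Σ (Subset n) λ T → HittingSet G T × n ^ ∣ T ∣ ≤ 2 ^ (25 * n)
  conclude (k , 16l<25k , k+q<l) = convert (small-hitting-set G α (25 * n / l) k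
    (2^k≤a {p} {q} {n} {a} {k} {l} 1≤p 1≤q aq≡pn 2^l≤2n k+q<l) (enough-blocks n k l 16l<25k))

theorem1p4 : (p q : ℕ) → 1 ≤ p → 1 ≤ q →
    Σ ℕ λ N → (n : ℕ) → N ≤ n → (G : DiskGraph n) → (a : ℕ) →
    IndependenceNumber G a → a * q ≡ p * n →
    Σ (Subset n) λ T → HittingSet G T × n ^ ∣ T ∣ ≤ 2 ^ (25 * n)
-- From 2 ^ (6 + 3 q) ≤ n ≤ 2 ^ l comes the bound 6 + 3 q ≤ l required by `exponent`.
theorem1p4 p q 1≤p 1≤q = 2 ^ (6 + 3 * q) , bound
  where
  bound : ∀ n → 2 ^ (6 + 3 * q) ≤ n → (G : DiskGraph n) → ∀ a →
    IndependenceNumber G a → a * q ≡ p * n →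
    Σ (Subset n) λ T → HittingSet G T × n ^ ∣ T ∣ ≤ 2 ^ (25 * n)
  bound n N≤n G a α aq≡pn =
    choose-l (log₂-bracket n (ℕ.≤-trans (ℕ.m^n>0 2 (6 + 3 * q)) N≤n))
    where
    choose-l : (∃ λ l → n ≤ 2 ^ l × 2 ^ l ≤ 2 * n) →
      Σ (Subset n) λ T → HittingSet G T × n ^ ∣ T ∣ ≤ 2 ^ (25 * n)
    choose-l (l , n≤2^l , 2^l≤2n) =
      large⇒hitting-set p q l 1≤p 1≤q
        (^-cancelˡ-≤ 2 {6 + 3 * q} {l} (s≤s (s≤s z≤n)) (ℕ.≤-trans N≤n n≤2^l))
        G α aq≡pn n≤2^l 2^l≤2n
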